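{- $\mathrm{WMPL}<\mathrm{WMTL}<\mathrm{WMSO}$, both over the class of all Kripke trees and over the class of finitely-branching Kripke trees.
   Context: Trees. A tree $T$ is a subset of $\mathbb{N}^*$ (finite words over the naturals) with an element $\tau_0\in T$ (the root) such that every $\tau\in T$ has the form $\tau_0\cdot\tau'$ with $\tau'\in\mathbb{N}^*$, and whenever $\tau_0\cdot\tau\in T$ and $\tau'$ is a prefix of $\tau$, also $\tau_0\cdot\tau'\in T$. Elements of $T$ are nodes. A child of $\tau$ in $T$ is a node of $T$ of the form $\tau\cdot n$, $n\in\mathbb{N}$; a descendant of $\tau$ in $T$ is a node of $T$ of the form $\tau\cdot\tau'$, $\tau'\in\mathbb{N}^*$ (so $\tau$ is a descendant of itself). A subtree of $T$ is a subset of $T$ that is a tree (with any root). A path of $T$ is a subtree of $T$ each of whose nodes has at most one child in it. $T$ is non-blocking if every node has a child in $T$, and finitely-branching if every node has finitely many children in $T$. For a finite set $AP$ of atomic propositions, a Kripke tree over $AP$ is a pair $(T,\mathrm{Lab})$ with $T$ a non-blocking tree and $\mathrm{Lab}:T\to 2^{AP}$; it is finitely-branching if $T$ is. Logics. Formulas over $AP$ are generated by $\varphi ::= P_a(x)\mid x\le y\mid x\in X\mid \neg\varphi\mid\varphi\wedge\varphi\mid\exists x.\varphi\mid\exists^{\alpha}X.\varphi$, with $a\in AP$, $x,y$ first-order variables, $X$ second-order variables. Over $(T,\mathrm{Lab})$, first-order variables range over nodes of $T$; $P_a(x)$ holds iff $a\in\mathrm{Lab}(x)$; $x\le y$ holds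 iff $y$ is a descendant of $x$ in $T$; $x\in X$ is membership; Boolean connectives and $\exists x$ are standard. The range of second-order quantification determines the logic: in WMSO (weak monadic second-order logic) it ranges over the finite subsets of $T$; in WMTL (weak monadic tree logic) over the finite subtrees of $T$; in WMPL (weak monadic path logic) over the finite paths of $T$. A logic consists of its sentences (formulas without free variables). Expressiveness. Over a class of Kripke trees, two sentences over the same $AP$ are equivalent if they are satisfied by the same members (over $AP$) of the class. $L\le L'$ means that, for every finite $AP$, each $L$-sentence over $AP$ has an equivalent $L'$-sentence over $AP$. $L<L'$ means $L\le L'$ and $L'\not\le L$. -}

module Defs where

open import Data.Fin.Base using (Fin)
open import Data.Fin.Subset as FinSubset using (Subset)
open import Data.List.Base using (List; _++_; _∷ʳ_)
open import Data.List.Membership.Propositional as ListMembership using ()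
open import Data.List.Relation.Binary.Prefix.Heterogeneous using (Prefix)
open import Data.Nat.Base using (ℕ)
open import Data.Product.Base using (Σ; ∃; _×_; proj₁; proj₂)
open import Data.Vec.Functional using (Vector; []; _∷_)
open import Function.Bundles using (_⇔_)
open import Level using (0ℓ; Lift) renaming (suc to ℓsuc)
open import Relation.Binary.Core using (Rel)
open import Relation.Binary.PropositionalEquality.Core using (_≡_)
open import Relation.Nullary.Negation.Core using (¬_)
open import Relation.Unary using (Pred; _∈_; _⊆_; _≐_; U)

Word : Set
Word = List ℕ

infix 4 _⊑_
_⊑_ : Rel Word 0ℓ
_⊑_ = Prefix _≡_

Finite : Pred (Pred Word 0ℓ) 0ℓ
Finite S = ∃ λ xs → S ≐ (λ w → w ListMembership.∈ xs)

record IsTree (T : Pred Word 0ℓ) : Set where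
  field
    root   : Word
    root∈  : root ∈ T
    rooted : ∀ {w} → w ∈ T → ∃ λ v → w ≡ root ++ v
    closed : ∀ {v u} → root ++ v ∈ T → u ⊑ v → root ++ u ∈ T

-- Child T w is the set of children of w in T.
Child : Pred Word 0ℓ → Word → Pred Word 0ℓ
Child T w v = v ∈ T × ∃ λ n → v ≡ w ∷ʳ n

NonBlocking : Pred (Pred Word 0ℓ) 0ℓ
NonBlocking T = ∀ {w} → w ∈ T → ∃ (Child T w)

FinitelyBranching : Pred (Pred Word 0ℓ) 0ℓ
FinitelyBranching T = ∀ {w} → w ∈ T → Finite (Child T w)

IsSubtree : Pred Word 0ℓ → Pred (Pred Word 0ℓ) 0ℓ
IsSubtree T X = X ⊆ T × IsTree X

IsPath : Pred Word 0ℓ → Pred (Pred Word 0ℓ) 0ℓ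
IsPath T X =
  IsSubtree T X × (∀ {w u v} → w ∈ X → u ∈ Child X w → v ∈ Child X w → u ≡ v)

-- The set of atomic propositions is Fin AP.  The irrelevant argument of
-- label makes it a function of the node alone, not of the membership proof.
record KripkeTree (AP : ℕ) : Set₁ where
  field
    nodes       : Pred Word 0ℓ
    isTree      : IsTree nodes
    nonBlocking : NonBlocking nodes
    label       : (w : Word) → .(w ∈ nodes) → Subset AP

  Node : Set
  Node = Σ Word nodes

open KripkeTree using (nodes; label; Node)

data Logic : Set where
  WMSO WMTL WMPL : Logic

-- The sets over which second-order variables range in a tree T.
Range : Logic → Pred Word 0ℓ → Pred (Pred Word 0ℓ) 0ℓ
Range WMSO T X = Finite X × X ⊆ T
Range WMTL T X = Finite X × IsSubtree T X
Range WMPL T X = Finite X × IsPath T X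

-- Formula L AP m k: formulas with m free first-order and k free second-order
-- variables, as de Bruijn indices.
data Formula (L : Logic) (AP : ℕ) : ℕ → ℕ → Set where
  P    : ∀ {m k} → Fin AP → Fin m → Formula L AP m k
  _≤ᶠ_ : ∀ {m k} → Fin m → Fin m → Formula L AP m k
  _∈ᶠ_ : ∀ {m k} → Fin m → Fin k → Formula L AP m k
  ¬ᶠ_  : ∀ {m k} → Formula L AP m k → Formula L AP m k
  _∧ᶠ_ : ∀ {m k} → Formula L AP m k → Formula L AP m k → Formula L AP m k
  ∃₁_  : ∀ {m k} → Formula L AP (ℕ.suc m) k → Formula L AP m k
  ∃₂_  : ∀ {m k} → Formula L AP m (ℕ.suc k) → Formula L AP m k

Sentence : Logic → ℕ → Set
Sentence L AP = Formula L AP 0 0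

Sat : ∀ {L AP m k} (K : KripkeTree AP) →
      Vector (Node K) m → Vector (Pred Word 0ℓ) k → Formula L AP m k → Set₁
Sat K ρ σ (P a x)  =
  Lift (ℓsuc 0ℓ) (a FinSubset.∈ label K (proj₁ (ρ x)) (proj₂ (ρ x)))
Sat K ρ σ (x ≤ᶠ y) = Lift (ℓsuc 0ℓ) (proj₁ (ρ x) ⊑ proj₁ (ρ y))
Sat K ρ σ (x ∈ᶠ X) = Lift (ℓsuc 0ℓ) (proj₁ (ρ x) ∈ σ X)
Sat K ρ σ (¬ᶠ φ)   = ¬ Sat K ρ σ φ
Sat K ρ σ (φ ∧ᶠ ψ) = Sat K ρ σ φ × Sat K ρ σ ψ
Sat K ρ σ (∃₁ φ)   = ∃ λ (x : Node K) → Sat K (x ∷ ρ) σ φ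
Sat {L} K ρ σ (∃₂ φ) =
  ∃ λ (X : Pred Word 0ℓ) → X ∈ Range L (nodes K) × Sat K ρ (X ∷ σ) φ

infix 4 _⊨_
_⊨_ : ∀ {L AP} → KripkeTree AP → Sentence L AP → Set₁
K ⊨ φ = Sat K [] [] φ

TreeClass : Set₁
TreeClass = ∀ AP → Pred (KripkeTree AP) 0ℓ

AllTrees : TreeClass
AllTrees AP = U

FinitelyBranchingTrees : TreeClass
FinitelyBranchingTrees AP K = FinitelyBranching (nodes K)

Equivalent : ∀ {L L′ AP} → TreeClass → Sentence L AP → Sentence L′ AP → Set₁
Equivalent {AP = AP} C φ ψ = (K : KripkeTree AP) → K ∈ C AP → (K ⊨ φ) ⇔ (K ⊨ ψ)

infix 4 _≤[_]_ _<[_]_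

_≤[_]_ : Logic → TreeClass → Logic → Set₁
L ≤[ C ] L′ =
  ∀ AP (φ : Sentence L AP) → ∃ λ (ψ : Sentence L′ AP) → Equivalent C φ ψ

_<[_]_ : Logic → TreeClass → Logic → Set₁
L <[ C ] L′ = L ≤[ C ] L′ × ¬ (L′ ≤[ C ] L)

{-# OPTIONS --safe #-}
module Submission where

-- The inclusions relativize set quantifiers: being a tree, and being a chain
-- within a tree, are first-order properties of a finite set.
--
-- Both strictness results rest on the parity of the depth N up to which the
-- ray 0^ω is marked.  A finite path is determined by its two end points, so
-- on path quantifiers the Ehrenfeucht-Fraïssé game is first-order, and it does
-- not notice one extra 0 inserted into a long marked stretch.  Parity is
-- definable with finite sets on the bare ray, where every finite subtree is a
-- path, and with finite subtrees on the comb 0*1*, where a subtree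
-- encodes a set of positions of the ray by the teeth it contains.

open import Defs
open import Data.Empty using (⊥-elim)
open import Data.Fin.Base using (Fin; zero; suc)
open import Data.Fin.Subset using () renaming (_∈_ to _∈ˢ_)
open import Data.List.Base
  using (List; []; _∷_; _++_; _∷ʳ_; length; inits; filter; replicate; upTo; map; concatMap)
open import Data.List.Membership.Propositional using (find; lose) renaming (_∈_ to _∈ˡ_)
open import Data.List.Membership.Propositional.Properties
  using (∈-map⁺; ∈-map⁻; ∈-filter⁺; ∈-filter⁻; ∈-upTo⁺; ∈-upTo⁻; ∈-concatMap⁺; ∈-concatMap⁻)
open import Data.List.Properties
  using (++-assoc; ++-identityʳ; ++-cancelˡ; ∷ʳ-injectiveˡ; ∷ʳ-injectiveʳ; length-replicate; ≡-dec)
open import Data.List.Relation.Binary.Pointwise using (≡⇒Pointwise-≡; Pointwise-≡⇒≡)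
open import Data.List.Relation.Binary.Prefix.Heterogeneous using ([]; _∷_; _++ᵖ_)
import Data.List.Relation.Binary.Prefix.Heterogeneous.Properties as Prefix
open import Data.List.Relation.Unary.All as All using (All; []; _∷_)
import Data.List.Relation.Unary.All.Properties as All
open import Data.List.Relation.Unary.AllPairs as AllPairs using (AllPairs; []; _∷_)
import Data.List.Relation.Unary.AllPairs.Properties as AllPairs
open import Data.List.Relation.Unary.Any using (here; there)
open import Data.Nat.Base using (ℕ; zero; suc; _+_; _*_; _≤_; _<_; _⊔_; z≤n; s≤s; s≤s⁻¹)
open import Data.Nat.Properties
  using (_≟_; _≤?_; ≤-refl; ≤-reflexive; ≤-totalOrder; <⇒≤; n≤1+n; m≤n⇒m≤1+n; m≤m+n;
         m≤m*n; m≤m⊔n; m≤n⊔m; +-monoʳ-≤; *-monoˡ-≤; *-cancelʳ-≤; +-assoc; +-suc; suc-injective)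
open import Data.List.Extrema ≤-totalOrder using (argmax; argmax-all; f[xs]≤f[argmax])
open import Data.Product.Base using (Σ; ∃; _×_; _,_; proj₁; proj₂)
open import Data.Sum.Base using (_⊎_; inj₁; inj₂)
open import Data.Vec.Base using ([]; _∷_; here)
open import Data.Vec.Functional using (Vector) renaming ([] to ∅; _∷_ to _▹_)
open import Function.Base using (_∘_; case_of_; id)
open import Function.Bundles using (_⇔_; mk⇔; module Equivalence)
open import Level using (0ℓ; Lift; lift; lower) renaming (suc to ℓsuc)
open import Relation.Binary.Definitions using (Decidable)
open import Relation.Binary.PropositionalEquality
  using (_≡_; _≢_; refl; sym; trans; cong; subst)
open import Relation.Nullary
  using (¬_; Dec; yes; no; does; contradiction; decidable-stable; _×-dec_)
import Relation.Nullary.Decidable as Dec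
open import Relation.Unary using (Pred; _∈_; _⊆_; _≐_)

open Equivalence using (to; from)
open KripkeTree using (nodes; isTree; Node)

private variable
  u u′ v v′ w w′ x y : Word
  T X : Pred Word 0ℓ
  L L′ : Logic
  b c d e m n k N AP : ℕ
  A A′ B B′ : Set₁

-- The prefix order on words

⊑-refl : u ⊑ u
⊑-refl = Prefix.fromPointwise (≡⇒Pointwise-≡ refl)

⊑-trans : u ⊑ v → v ⊑ w → u ⊑ w
⊑-trans = Prefix.trans trans

⊑-antisym : u ⊑ v → v ⊑ u → u ≡ v
⊑-antisym p q = Pointwise-≡⇒≡ (Prefix.antisym (λ e _ → e) p q)

_⊑?_ : Decidable _⊑_
_⊑?_ = Prefix.prefix? _≟_

⊑-++ : ∀ u v → u ⊑ u ++ v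
⊑-++ u v = ⊑-refl ++ᵖ v

⊑⇒++ : u ⊑ v → ∃ λ w → v ≡ u ++ w
⊑⇒++ []         = _ , refl
⊑⇒++ (refl ∷ p) with w , refl ← ⊑⇒++ p = w , refl

++⁺-⊑ : ∀ w → u ⊑ v → w ++ u ⊑ w ++ v
++⁺-⊑ w = Prefix.++⁺ (≡⇒Pointwise-≡ refl)

++⁻-⊑ : ∀ w → w ++ u ⊑ w ++ v → u ⊑ v
++⁻-⊑ []      p       = p
++⁻-⊑ (_ ∷ w) (_ ∷ p) = ++⁻-⊑ w p

∷ʳ⁻-⊑ : ∀ w {m n} → w ∷ʳ m ⊑ w ∷ʳ n → m ≡ n
∷ʳ⁻-⊑ w p with refl ∷ _ ← ++⁻-⊑ w p = refl

⊑-linear : u ⊑ w → v ⊑ w → u ⊑ v ⊎ v ⊑ u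
⊑-linear []         q          = inj₁ []
⊑-linear (_ ∷ _)    []         = inj₂ []
⊑-linear (refl ∷ p) (refl ∷ q) with ⊑-linear p q
... | inj₁ u⊑v = inj₁ (refl ∷ u⊑v)
... | inj₂ v⊑u = inj₂ (refl ∷ v⊑u)

⊑-length⇒⊒ : u ⊑ v → length v ≤ length u → v ⊑ u
⊑-length⇒⊒ {v = []}    []         _       = []
⊑-length⇒⊒ {v = _ ∷ _} (refl ∷ p) (s≤s l) = refl ∷ ⊑-length⇒⊒ p l

⊑⇒∈inits : u ⊑ v → u ∈ˡ inits v
⊑⇒∈inits []         = here refl
⊑⇒∈inits (refl ∷ p) = there (∈-map⁺ _ (⊑⇒∈inits p))

∈inits⇒⊑ : ∀ v → u ∈ˡ inits v → u ⊑ v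
∈inits⇒⊑ v = All.lookup (Prefix.inits⁺ (≡⇒Pointwise-≡ refl))

Fork : Word → Word → Set
Fork u v = ∃ λ w → ∃ λ m → ∃ λ n → m ≢ n × w ∷ʳ m ⊑ u × w ∷ʳ n ⊑ v

compare : ∀ u v → u ⊑ v ⊎ v ⊑ u ⊎ Fork u v
compare []      v       = inj₁ []
compare (m ∷ u) []      = inj₂ (inj₁ [])
compare (m ∷ u) (n ∷ v) with m ≟ n
... | no m≢n = inj₂ (inj₂ ([] , m , n , m≢n , refl ∷ [] , refl ∷ []))
... | yes refl with compare u v
...   | inj₁ p        = inj₁ (refl ∷ p)
...   | inj₂ (inj₁ p) = inj₂ (inj₁ (refl ∷ p))
...   | inj₂ (inj₂ (w , k , l , k≢l , p , q)) =
  inj₂ (inj₂ (m ∷ w , k , l , k≢l , refl ∷ p , refl ∷ q))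

-- Trees and paths in terms of the prefix order

module Tree {T} (t : IsTree T) where
  open IsTree t public

  root⊑ : x ∈ T → root ⊑ x
  root⊑ x∈T with v , refl ← rooted x∈T = ⊑-++ root v

  downward : x ∈ T → root ⊑ y → y ⊑ x → y ∈ T
  downward x∈T r⊑y y⊑x with ⊑⇒++ r⊑y | ⊑⇒++ y⊑x
  ... | u , refl | w , refl =
    closed (subst T (++-assoc root u w) x∈T) (⊑-++ u w)

  convex : x ∈ T → y ∈ T → x ⊑ w → w ⊑ y → w ∈ T
  convex x∈T y∈T x⊑w = downward y∈T (⊑-trans (root⊑ x∈T) x⊑w)

-- Restates the tree axioms through the prefix order on whole words, instead of on the suffixes that
-- follow the root.
mkTree : ∀ r → r ∈ X → (∀ {x} → x ∈ X → r ⊑ x) →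
         (∀ {x y} → x ∈ X → r ⊑ y → y ⊑ x → y ∈ X) → IsTree X
mkTree r r∈X r⊑ down = record
  { root   = r
  ; root∈  = r∈X
  ; rooted = ⊑⇒++ ∘ r⊑
  ; closed = λ {_} {u} x∈X u⊑v → down x∈X (⊑-++ r u) (++⁺-⊑ r u⊑v)
  }

Finite⇒dec : Finite X → ∀ w → Dec (w ∈ X)
Finite⇒dec (xs , X⊆xs , xs⊆X) w = Dec.map′ xs⊆X X⊆xs (w ∈? xs)
  where open import Data.List.Membership.DecPropositional (≡-dec _≟_) using (_∈?_)

-- If two elements were incomparable, the node where they fork would have two distinct children in
-- `X`, because prefixes that extend the root stay in the tree.
path-linear : IsPath T X → x ∈ X → y ∈ X → x ⊑ y ⊎ y ⊑ x
path-linear ((_ , t) , det) x∈X y∈X with rooted x∈X | rooted y∈X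
  where open IsTree t
... | u , refl | v , refl with compare u v
...   | inj₁ u⊑v        = inj₁ (++⁺-⊑ root u⊑v)
  where open IsTree t
...   | inj₂ (inj₁ v⊑u) = inj₂ (++⁺-⊑ root v⊑u)
  where open IsTree t
...   | inj₂ (inj₂ (w , m , n , m≢n , wm⊑u , wn⊑v)) =
  contradiction (∷ʳ-injectiveʳ w w (++-cancelˡ root _ _ wm≡wn)) m≢n
  where
  open IsTree t
  wm≡wn : root ++ w ∷ʳ m ≡ root ++ w ∷ʳ n
  wm≡wn = det (closed x∈X (⊑-trans (⊑-++ w _) wm⊑u))
    (closed x∈X wm⊑u , m , sym (++-assoc root w _))
    (closed y∈X wn⊑v , n , sym (++-assoc root w _))

-- The inclusions, by relativizing set quantifiers

¬-⇔ : A ⇔ B → (¬ A) ⇔ (¬ B)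
¬-⇔ e = mk⇔ (_∘ from e) (_∘ to e)

×-⇔ : A ⇔ B → A′ ⇔ B′ → (A × A′) ⇔ (B × B′)
×-⇔ e f = mk⇔ (λ (a , b) → to e a , to f b) (λ (a , b) → from e a , from f b)

-- `guard` cuts the range of `L` out of that of `L′`; the set it speaks about is the innermost set
-- variable, index `zero`.
module Relativize {L L′ : Logic} {AP : ℕ}
  (guard : ∀ {m k} → Formula L′ AP m (suc k))
  (guard-correct : ∀ (K : KripkeTree AP) {m k} {ρ : Vector (Node K) m}
    {σ : Vector (Pred Word 0ℓ) k} {X} →
    (X ∈ Range L (nodes K)) ⇔ (X ∈ Range L′ (nodes K) × Sat K ρ (X ▹ σ) guard))
  where

  relativize : Formula L AP m k → Formula L′ AP m k
  relativize (P a x)  = P a x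
  relativize (x ≤ᶠ y) = x ≤ᶠ y
  relativize (x ∈ᶠ X) = x ∈ᶠ X
  relativize (¬ᶠ φ)   = ¬ᶠ relativize φ
  relativize (φ ∧ᶠ ψ) = relativize φ ∧ᶠ relativize ψ
  relativize (∃₁ φ)   = ∃₁ relativize φ
  relativize (∃₂ φ)   = ∃₂ (guard ∧ᶠ relativize φ)

  relativize-correct : ∀ (K : KripkeTree AP) (ρ : Vector (Node K) m)
    (σ : Vector (Pred Word 0ℓ) k) φ → Sat K ρ σ φ ⇔ Sat K ρ σ (relativize φ)
  relativize-correct K ρ σ (P a x)  = mk⇔ id id
  relativize-correct K ρ σ (x ≤ᶠ y) = mk⇔ id id
  relativize-correct K ρ σ (x ∈ᶠ X) = mk⇔ id id
  relativize-correct K ρ σ (¬ᶠ φ)   = ¬-⇔ (relativize-correct K ρ σ φ)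
  relativize-correct K ρ σ (φ ∧ᶠ ψ) =
    ×-⇔ (relativize-correct K ρ σ φ) (relativize-correct K ρ σ ψ)
  relativize-correct K ρ σ (∃₁ φ) = mk⇔
    (λ (x , s) → x , to (relativize-correct K (x ▹ ρ) σ φ) s)
    (λ (x , s) → x , from (relativize-correct K (x ▹ ρ) σ φ) s)
  relativize-correct K ρ σ (∃₂ φ) = mk⇔
    (λ (X , X∈L , s) → let X∈L′ , g = to (guard-correct K) X∈L in
      X , X∈L′ , g , to (relativize-correct K ρ (X ▹ σ) φ) s)
    (λ (X , X∈L′ , g , s) → X , from (guard-correct K) (X∈L′ , g) ,
      from (relativize-correct K ρ (X ▹ σ) φ) s)

-- A path is a subtree that is a chain: distinct siblings are incomparable, and by `path-linear` a
-- path has no incomparable elements.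
pathGuard : Formula L AP m (suc k)
pathGuard = ¬ᶠ ∃₁ ∃₁ (((zero ∈ᶠ zero) ∧ᶠ (suc zero ∈ᶠ zero)) ∧ᶠ
  ((¬ᶠ (zero ≤ᶠ suc zero)) ∧ᶠ (¬ᶠ (suc zero ≤ᶠ zero))))

pathGuard-correct : ∀ (K : KripkeTree AP) {ρ : Vector (Node K) m}
  {σ : Vector (Pred Word 0ℓ) k} {X} → (X ∈ Range WMPL (nodes K)) ⇔
  (X ∈ Range WMTL (nodes K) × Sat {WMTL} K ρ (X ▹ σ) pathGuard)
pathGuard-correct K {ρ = ρ} {σ} {X} = mk⇔
  (λ (fin , sub , det) → (fin , sub) ,
    λ ((x , _) , (y , _) , (lift y∈X , lift x∈X) , ¬y⊑x , ¬x⊑y) →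
      case path-linear {T = nodes K} (sub , det) x∈X y∈X of λ where
        (inj₁ x⊑y) → ¬x⊑y (lift x⊑y)
        (inj₂ y⊑x) → ¬y⊑x (lift y⊑x))
  (λ ((fin , sub) , g) → fin , sub , λ {_} {u} {v} _ → unique sub g)
  where
  unique : ∀ {w u v} → IsSubtree (nodes K) X → Sat {WMTL} K ρ (X ▹ σ) pathGuard →
    u ∈ Child X w → v ∈ Child X w → u ≡ v
  unique {w} {u} {v} (X⊆T , _) g (u∈X , m , refl) (v∈X , n , refl) with m ≟ n
  ... | yes refl = refl
  ... | no m≢n = ⊥-elim (g ((u , X⊆T u∈X) , (v , X⊆T v∈X) , (lift v∈X , lift u∈X) ,
    m≢n ∘ sym ∘ ∷ʳ⁻-⊑ w ∘ lower , m≢n ∘ ∷ʳ⁻-⊑ w ∘ lower))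

-- Among sets of nodes, subtrees are those with a least element `r` and no missing node between `r`
-- and an element.
treeGuard : Formula L AP m (suc k)
treeGuard = ∃₁ ((zero ∈ᶠ zero) ∧ᶠ
  ((¬ᶠ ∃₁ ((zero ∈ᶠ zero) ∧ᶠ (¬ᶠ (suc zero ≤ᶠ zero)))) ∧ᶠ
   (¬ᶠ ∃₁ ∃₁ (((zero ∈ᶠ zero) ∧ᶠ (¬ᶠ (suc zero ∈ᶠ zero))) ∧ᶠ
     ((suc (suc zero) ≤ᶠ suc zero) ∧ᶠ (suc zero ≤ᶠ zero))))))

treeGuard-correct : ∀ (K : KripkeTree AP) {ρ : Vector (Node K) m}
  {σ : Vector (Pred Word 0ℓ) k} {X} → (X ∈ Range WMTL (nodes K)) ⇔
  (X ∈ Range WMSO (nodes K) × Sat {WMSO} K ρ (X ▹ σ) treeGuard)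
treeGuard-correct K {ρ = ρ} {σ} {X} = mk⇔
  (λ (fin , X⊆T , t) → let open Tree t in (fin , X⊆T) ,
    (root , X⊆T root∈) , lift root∈ ,
    (λ (_ , lift x∈X , r⋢x) → r⋢x (lift (root⊑ x∈X))) ,
    (λ (_ , _ , (lift x∈X , y∉X) , lift r⊑y , lift y⊑x) →
      y∉X (lift (downward x∈X r⊑y y⊑x))))
  (λ ((fin , X⊆T) , g) → fin , X⊆T , tree fin X⊆T g)
  where
  tree : Finite X → X ⊆ nodes K → Sat {WMSO} K ρ (X ▹ σ) treeGuard → IsTree X
  tree fin X⊆T ((r , r∈T) , lift r∈X , least , closed) = mkTree r r∈X
    -- The guard speaks in the form `¬ ∃ ¬`; decidability of `⊑`, and of membership in a finite set,
    -- removes the double negations.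
    (λ {x} x∈X → decidable-stable (r ⊑? x) λ r⋢x →
      least ((x , X⊆T x∈X) , lift x∈X , r⋢x ∘ lower))
    (λ {x} {y} x∈X r⊑y y⊑x → decidable-stable (Finite⇒dec fin y) λ y∉X →
      -- `y` lies between two nodes of `K`, so it is a node and first-order quantifiers reach it.
      closed ((y , Tree.convex (isTree K) r∈T (X⊆T x∈X) r⊑y y⊑x) ,
        (x , X⊆T x∈X) , (lift x∈X , y∉X ∘ lower) , lift r⊑y , lift y⊑x))

WMPL≤WMTL : ∀ {C} → WMPL ≤[ C ] WMTL
WMPL≤WMTL AP φ = relativize φ , λ K _ → relativize-correct K _ _ φ
  where
  open Relativize {WMPL} {WMTL} pathGuard
    (λ K {_} {_} {ρ} {σ} → pathGuard-correct K {ρ = ρ} {σ})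

WMTL≤WMSO : ∀ {C} → WMTL ≤[ C ] WMSO
WMTL≤WMSO AP φ = relativize φ , λ K _ → relativize-correct K _ _ φ
  where
  open Relativize {WMTL} {WMSO} treeGuard
    (λ K {_} {_} {ρ} {σ} → treeGuard-correct K {ρ = ρ} {σ})

-- The ray and the comb with a marked initial stretch

-- The ray 0* for b = 0, the comb 0*1* for b = 1.
Staircase : ℕ → Pred Word 0ℓ
Staircase b w = AllPairs _≤_ w × All (_≤ b) w

All-⊑ : ∀ {P : Pred ℕ 0ℓ} → u ⊑ v → All P v → All P u
All-⊑ []         _        = []
All-⊑ (refl ∷ p) (px ∷ q) = px ∷ All-⊑ p q

AllPairs-⊑ : ∀ {R : ℕ → ℕ → Set} → u ⊑ v → AllPairs R v → AllPairs R u
AllPairs-⊑ []         _        = []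
AllPairs-⊑ (refl ∷ p) (rx ∷ q) = All-⊑ p rx ∷ AllPairs-⊑ p q

staircase-isTree : IsTree (Staircase b)
staircase-isTree = mkTree [] ([] , []) (λ _ → [])
  (λ (s , a) _ y⊑x → AllPairs-⊑ y⊑x s , All-⊑ y⊑x a)

staircase-nonBlocking : NonBlocking (Staircase b)
staircase-nonBlocking {b} {w} (s , a) = w ∷ʳ b ,
  (AllPairs.++⁺ s ([] ∷ []) (All.map (_∷ []) a) , All.∷ʳ⁺ a ≤-refl) , b , refl

staircase? : ∀ b w → Dec (w ∈ Staircase b)
staircase? b w = AllPairs.allPairs? _≤?_ w ×-dec All.all? (_≤? b) w

staircase-finitelyBranching : FinitelyBranching (Staircase b)
staircase-finitelyBranching {b} {w} _ = filter (staircase? b) children ,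
  (λ { (t@(_ , a) , n , refl) → ∈-filter⁺ (staircase? b)
    (∈-map⁺ (w ∷ʳ_) (∈-upTo⁺ (s≤s (proj₂ (All.∷ʳ⁻ a))))) t }) ,
  (λ v∈ → let v∈ch , t = ∈-filter⁻ (staircase? b) v∈
              n , _ , eq = ∈-map⁻ (w ∷ʳ_) v∈ch in t , n , eq)
  where children = map (w ∷ʳ_) (upTo (suc b))

zeros : ℕ → Word
zeros n = replicate n 0

-- The letter 0 is the least one, so in front it affects neither monotonicity nor the bound;
-- inserted zeros therefore stay inside the tree.
∷-staircase : w ∈ Staircase b ⇔ 0 ∷ w ∈ Staircase b
∷-staircase {w} = mk⇔ (λ (s , a) → All.universal (λ _ → z≤n) w ∷ s , z≤n ∷ a)
                      (λ { (_ ∷ s , _ ∷ a) → s , a })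

-- For fixed `b` only the marks depend on `N`; the deepest marked node is `zeros N`.
stairs : ℕ → ℕ → KripkeTree 1
stairs b N = record
  { nodes       = Staircase b
  ; isTree      = staircase-isTree
  ; nonBlocking = staircase-nonBlocking
  ; label       = λ w _ → does (w ⊑? zeros N) ∷ []
  }

marked : ∀ w → Lift (ℓsuc 0ℓ) (zero ∈ˢ (does (w ⊑? zeros N) ∷ [])) ⇔ w ⊑ zeros N
marked {N} w with w ⊑? zeros N
... | yes w⊑N = mk⇔ (λ _ → w⊑N) (λ _ → lift here)
... | no  w⋢N = mk⇔ (λ { (lift ()) }) (λ w⊑N → contradiction w⊑N w⋢N)

zeros-mono : m ≤ n → zeros m ⊑ zeros n
zeros-mono m≤n = Prefix.replicate⁺ m≤n refl

-- Finite paths as intervals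

Interval : Word → Word → Pred Word 0ℓ
Interval x y w = x ⊑ w × w ⊑ y

interval-range : IsTree T → x ∈ T → y ∈ T → x ⊑ y → Interval x y ∈ Range WMPL T
interval-range {T} {x} {y} t x∈T y∈T x⊑y =
  (filter (x ⊑?_) (inits y) ,
   (λ (x⊑w , w⊑y) → ∈-filter⁺ (x ⊑?_) (⊑⇒∈inits w⊑y) x⊑w) ,
   (λ w∈ → let w∈y , x⊑w = ∈-filter⁻ (x ⊑?_) {xs = inits y} w∈ in x⊑w , ∈inits⇒⊑ y w∈y)) ,
  ((λ (x⊑w , w⊑y) → Tree.convex t x∈T y∈T x⊑w w⊑y) ,
   mkTree x (⊑-refl , x⊑y) proj₁ (λ (_ , w⊑y) x⊑v v⊑w → x⊑v , ⊑-trans v⊑w w⊑y)) ,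
  unique
  where
  unique : ∀ {w u v} → w ∈ Interval x y → u ∈ Child (Interval x y) w →
           v ∈ Child (Interval x y) w → u ≡ v
  unique {w} _ ((_ , u⊑y) , m , refl) ((_ , v⊑y) , n , refl) with ⊑-linear u⊑y v⊑y
  ... | inj₁ p = cong (w ∷ʳ_) (∷ʳ⁻-⊑ w p)
  ... | inj₂ p = cong (w ∷ʳ_) (sym (∷ʳ⁻-⊑ w p))

-- The upper end is an element of maximal length: every element is comparable with it, and one above
-- it cannot be longer, hence coincides with it.
path-interval : X ∈ Range WMPL T → ∃ λ x → ∃ λ y → x ∈ X × y ∈ X × X ≐ Interval x y
path-interval {X} ((xs , X⊆xs , xs⊆X) , p@((_ , t) , _)) =
  root , top , root∈ , top∈X ,
  (λ w∈X → root⊑ w∈X , ⊑top w∈X) ,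
  (λ (r⊑w , w⊑top) → downward top∈X r⊑w w⊑top)
  where
  open Tree t
  -- The default value `root` is itself an element of `X`, so `top` is in `X` in every case.
  top = argmax length root xs
  top∈X : top ∈ X
  top∈X = argmax-all length root∈ (All.tabulate xs⊆X)
  ⊑top : w ∈ X → w ⊑ top
  ⊑top w∈X with path-linear p w∈X top∈X
  ... | inj₁ w⊑top = w⊑top
  ... | inj₂ top⊑w =
    ⊑-length⇒⊒ top⊑w (All.lookup (f[xs]≤f[argmax] root xs) (X⊆xs w∈X))

-- The game: one inserted zero and its slack

-- Inserts a 0 into the words that begin with c zeros, all of which must then
-- begin with c + d zeros; the slack d is what the remaining moves consume.
data Shift (c d : ℕ) : Word → Word → Set where
  fixed   : ¬ (zeros c ⊑ w) → Shift c d w w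
  shifted : zeros (c + d) ⊑ w → Shift c d w (0 ∷ w)

Shift-≤ : d ≤ e → Shift c e u u′ → Shift c d u u′
Shift-≤ d≤e (fixed p)   = fixed p
Shift-≤ d≤e (shifted p) = shifted (⊑-trans (zeros-mono (+-monoʳ-≤ _ d≤e)) p)

-- The slack before a move that leaves slack `d`. Since `c + (2d + 1) = (c + d + 1) + d`, a cut at
-- `c + d + 1` zeros leaves enough on either side: `halve-low` keeps the threshold `c`, `halve-high`
-- raises it to the cut.
widen : ℕ → ℕ
widen d = suc (d + d)

halve-low : Shift c (widen d) u u′ → Shift c d u u′
halve-low {d = d} = Shift-≤ (m≤n⇒m≤1+n (m≤m+n d d))

halve-high : Shift c (widen d) u u′ → Shift (suc (c + d)) d u u′
halve-high {c} {d} (fixed p)   = fixed (p ∘ ⊑-trans (zeros-mono (m≤n⇒m≤1+n (m≤m+n c d))))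
halve-high {c} {d} (shifted p) = shifted (⊑-trans (zeros-mono (≤-reflexive eq)) p)
  where
  eq : suc (c + d + d) ≡ c + suc (d + d)
  eq = trans (cong suc (+-assoc c d d)) (sym (+-suc c (d + d)))

∷-zeros : zeros c ⊑ w → zeros c ⊑ 0 ∷ w
∷-zeros {c} p = ⊑-trans (zeros-mono (n≤1+n c)) (refl ∷ p)

-- In the mixed cases, a fixed word is a prefix of a shifted one, before or after the insertion,
-- exactly if it is a prefix of `zeros c`; a shifted word is never a prefix of a fixed one, which
-- would then begin with `c` zeros.
Shift-⊑ : Shift c d u u′ → Shift c d v v′ → u ⊑ v ⇔ u′ ⊑ v′
Shift-⊑ (fixed _) (fixed _)     = mk⇔ id id
Shift-⊑ (shifted _) (shifted _) = mk⇔ (refl ∷_) (λ { (_ ∷ p) → p })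
Shift-⊑ {c} {d} {u} {v = v} (fixed c⋢u) (shifted cd⊑v) =
  mk⇔ (λ u⊑v → ⊑-trans (below u⊑v c⊑v) (∷-zeros c⊑v))
      (λ u⊑0v → ⊑-trans (below u⊑0v (∷-zeros c⊑v)) c⊑v)
  where
  c⊑v : zeros c ⊑ v
  c⊑v = ⊑-trans (zeros-mono (m≤m+n c d)) cd⊑v
  below : u ⊑ w → zeros c ⊑ w → u ⊑ zeros c
  below u⊑w c⊑w with ⊑-linear u⊑w c⊑w
  ... | inj₁ u⊑c = u⊑c
  ... | inj₂ c⊑u = contradiction c⊑u c⋢u
Shift-⊑ {c} {d} {u} {v = v} (shifted cd⊑u) (fixed c⋢v) =
  mk⇔ (λ u⊑v → contradiction (⊑-trans c⊑u u⊑v) c⋢v)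
      (λ 0u⊑v → contradiction (⊑-trans (∷-zeros c⊑u) 0u⊑v) c⋢v)
  where
  c⊑u : zeros c ⊑ u
  c⊑u = ⊑-trans (zeros-mono (m≤m+n c d)) cd⊑u

Shift-staircase : Shift c d w w′ → w ∈ Staircase b ⇔ w′ ∈ Staircase b
Shift-staircase (fixed _)   = mk⇔ id id
Shift-staircase (shifted _) = ∷-staircase

-- A move may change the parameters, provided that all pairs played earlier remain valid.
Refines : ℕ → ℕ → ℕ → ℕ → Set
Refines c d c′ d′ = ∀ {u u′} → Shift c d u u′ → Shift c′ d′ u u′

-- A word with at least `c + d + 1` leading zeros is shifted under the old threshold; any other word
-- is fixed, and the threshold moves up to `c + d + 1`.
forth : ∀ c d w → ∃ λ c′ → Refines c (widen d) c′ d × ∃ λ w′ → Shift c′ d w w′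
forth c d w with zeros (suc (c + d)) ⊑? w
... | yes p = c , halve-low , 0 ∷ w , shifted (⊑-trans (zeros-mono (n≤1+n _)) p)
... | no ¬p = suc (c + d) , halve-high , w , fixed ¬p

back : ∀ c d w′ → ∃ λ c′ → Refines c (widen d) c′ d × ∃ λ w → Shift c′ d w w′
back c d w′ with zeros (suc (c + d)) ⊑? w′
-- Deleting one of the `c + d + 1` zeros leaves the `c + d` that `shifted` demands; hence the extra
-- one in the cut.
... | yes (refl ∷ p) = c , halve-low , _ , shifted p
... | no ¬p          = suc (c + d) , halve-high , w′ , fixed ¬p

Matches : ℕ → ℕ → Pred Word 0ℓ → Pred Word 0ℓ → Set
Matches c d X X′ = ∃ λ x → ∃ λ x′ → ∃ λ y → ∃ λ y′ →
  Shift c d x x′ × Shift c d y y′ × X ≐ Interval x y × X′ ≐ Interval x′ y′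

Matches-∈ : ∀ {X X′} → Matches c d X X′ → Shift c d w w′ → w ∈ X ⇔ w′ ∈ X′
Matches-∈ (_ , _ , _ , _ , sx , sy , (X⊆ , ⊆X) , X′⊆ , ⊆X′) sw = mk⇔
  (λ w∈X → let x⊑w , w⊑y = X⊆ w∈X in
    ⊆X′ (to (Shift-⊑ sx sw) x⊑w , to (Shift-⊑ sw sy) w⊑y))
  (λ w∈X′ → let x⊑w , w⊑y = X′⊆ w∈X′ in
    ⊆X (from (Shift-⊑ sx sw) x⊑w , from (Shift-⊑ sw sy) w⊑y))

Matches-refine : ∀ {c′ d′ X X′} → Refines c d c′ d′ → Matches c d X X′ → Matches c′ d′ X X′
Matches-refine ref (x , x′ , y , y′ , sx , sy , rest) =
  x , x′ , y , y′ , ref sx , ref sy , rest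

-- The two ends are played one after the other: the first move leaves slack `widen d` for the
-- second, and `ref₂` carries the first pair over to the final parameters.
forth-path : ∀ c d {X} → X ∈ Range WMPL (Staircase b) →
  ∃ λ c′ → Refines c (widen (widen d)) c′ d ×
  ∃ λ X′ → X′ ∈ Range WMPL (Staircase b) × Matches c′ d X X′
forth-path c d X∈R@(_ , (X⊆T , _) , _) =
  let x , y , x∈X , y∈X , X≐ = path-interval X∈R
      c₁ , ref₁ , x′ , sx = forth c (widen d) x
      c₂ , ref₂ , y′ , sy = forth c₁ d y
      x⊑y = proj₂ (proj₁ X≐ x∈X)
  in c₂ , ref₂ ∘ ref₁ , Interval x′ y′ ,
     interval-range staircase-isTree (to (Shift-staircase sx) (X⊆T x∈X))
       (to (Shift-staircase sy) (X⊆T y∈X)) (to (Shift-⊑ (ref₂ sx) sy) x⊑y) ,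
     x , x′ , y , y′ , ref₂ sx , sy , X≐ , id , id

back-path : ∀ c d {X′} → X′ ∈ Range WMPL (Staircase b) →
  ∃ λ c′ → Refines c (widen (widen d)) c′ d ×
  ∃ λ X → X ∈ Range WMPL (Staircase b) × Matches c′ d X X′
back-path c d X′∈R@(_ , (X′⊆T , _) , _) =
  let x′ , y′ , x′∈X′ , y′∈X′ , X′≐ = path-interval X′∈R
      c₁ , ref₁ , x , sx = back c (widen d) x′
      c₂ , ref₂ , y , sy = back c₁ d y′
      x′⊑y′ = proj₂ (proj₁ X′≐ x′∈X′)
  in c₂ , ref₂ ∘ ref₁ , Interval x y ,
     interval-range staircase-isTree (from (Shift-staircase sx) (X′⊆T x′∈X′))
       (from (Shift-staircase sy) (X′⊆T y′∈X′)) (from (Shift-⊑ (ref₂ sx) sy) x′⊑y′) ,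
     x , x′ , y , y′ , ref₂ sx , sy , (id , id) , X′≐

-- Transfer of formulas between marked lengths `N` and `suc N`

-- ∃₂ counts as two first-order quantifiers, one for each end of the path.
gap : Formula L 1 m k → ℕ
gap (P a x)  = 0
gap (x ≤ᶠ y) = 0
gap (x ∈ᶠ X) = 0
gap (¬ᶠ φ)   = gap φ
gap (φ ∧ᶠ ψ) = gap φ ⊔ gap ψ
gap (∃₁ φ)   = widen (gap φ)
gap (∃₂ φ)   = widen (widen (gap φ))

-- The hypothesis `range` is met by WMPL on every staircase and, through `ray-range`, by WMTL on the
-- ray, so one game serves both separations.
module _ {L b} (range : ∀ X → X ∈ Range L (Staircase b) ⇔ X ∈ Range WMPL (Staircase b))
         (N : ℕ) where

  record Env (c d : ℕ) {m k} (ρ ρ′ : Vector (Σ Word (Staircase b)) m)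
             (σ σ′ : Vector (Pred Word 0ℓ) k) : Set where
    field
      -- The deepest marked nodes of the two trees count as a pair already played, which turns the
      -- label of a node into a comparison with that pair.
      marker : Shift c d (zeros N) (zeros (suc N))
      points : ∀ i → Shift c d (proj₁ (ρ i)) (proj₁ (ρ′ i))
      sets   : ∀ i → Matches c d (σ i) (σ′ i)
  open Env

  private variable
    ρ ρ′ : Vector (Σ Word (Staircase b)) m
    σ σ′ : Vector (Pred Word 0ℓ) k

  refine : ∀ {c′ d′} → Refines c d c′ d′ → Env c d ρ ρ′ σ σ′ → Env c′ d′ ρ ρ′ σ σ′
  refine ref E .marker   = ref (E .marker)
  refine ref E .points i = ref (E .points i)
  refine ref E .sets   i = Matches-refine ref (E .sets i)

  add-point : ∀ {x x′} → Shift c d (proj₁ x) (proj₁ x′) → Env c d ρ ρ′ σ σ′ →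
              Env c d (x ▹ ρ) (x′ ▹ ρ′) σ σ′
  add-point s E .marker = E .marker
  add-point s E .points zero    = s
  add-point s E .points (suc i) = E .points i
  add-point s E .sets = E .sets

  add-set : ∀ {X X′} → Matches c d X X′ → Env c d ρ ρ′ σ σ′ →
            Env c d ρ ρ′ (X ▹ σ) (X′ ▹ σ′)
  add-set s E .marker = E .marker
  add-set s E .points = E .points
  add-set s E .sets zero    = s
  add-set s E .sets (suc i) = E .sets i

  transfer : ∀ (φ : Formula L 1 m k) → Env c (gap φ) ρ ρ′ σ σ′ →
             Sat (stairs b N) ρ σ φ ⇔ Sat (stairs b (suc N)) ρ′ σ′ φ
  transfer (P zero x) E = mk⇔ (from (marked _) ∘ to ⊑N ∘ to (marked _))
                              (from (marked _) ∘ from ⊑N ∘ to (marked _))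
    where ⊑N = Shift-⊑ (E .points x) (E .marker)
  transfer (x ≤ᶠ y) E = mk⇔ (lift ∘ to xy ∘ lower) (lift ∘ from xy ∘ lower)
    where xy = Shift-⊑ (E .points x) (E .points y)
  transfer (x ∈ᶠ X) E = mk⇔ (lift ∘ to xX ∘ lower) (lift ∘ from xX ∘ lower)
    where xX = Matches-∈ (E .sets X) (E .points x)
  transfer (¬ᶠ φ) E = ¬-⇔ (transfer φ E)
  transfer (φ ∧ᶠ ψ) E = ×-⇔
    (transfer φ (refine (Shift-≤ (m≤m⊔n (gap φ) (gap ψ))) E))
    (transfer ψ (refine (Shift-≤ (m≤n⊔m (gap φ) (gap ψ))) E))
  transfer {c = c} (∃₁ φ) E = mk⇔
    (λ ((x , x∈T) , s) → let _ , ref , x′ , sx = forth c (gap φ) x in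
      (x′ , to (Shift-staircase sx) x∈T) ,
      to (transfer φ (add-point sx (refine ref E))) s)
    (λ ((x′ , x′∈T) , s) → let _ , ref , x , sx = back c (gap φ) x′ in
      (x , from (Shift-staircase sx) x′∈T) ,
      from (transfer φ (add-point sx (refine ref E))) s)
  transfer {c = c} (∃₂ φ) E = mk⇔
    (λ (X , X∈R , s) →
      let _ , ref , X′ , X′∈R , sX = forth-path c (gap φ) (to (range X) X∈R) in
      X′ , from (range X′) X′∈R , to (transfer φ (add-set sX (refine ref E))) s)
    (λ (X′ , X′∈R , s) →
      let _ , ref , X , X∈R , sX = back-path c (gap φ) (to (range X′) X′∈R) in
      X , from (range X) X∈R , from (transfer φ (add-set sX (refine ref E))) s)

  transfer-sentence : (φ : Sentence L 1) → gap φ ≤ N → stairs b N ⊨ φ ⇔ stairs b (suc N) ⊨ φ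
  -- With threshold 0 every word counts as long; the marker then needs `gap φ` zeros, which is what
  -- `gap φ ≤ N` provides.
  transfer-sentence φ g≤N = transfer {c = 0} φ (record
    { marker = shifted (zeros-mono g≤N) ; points = λ () ; sets = λ () })

-- On the ray a child can only arise by appending 0, so siblings coincide.
ray-range : ∀ X → X ∈ Range WMTL (Staircase 0) ⇔ X ∈ Range WMPL (Staircase 0)
ray-range X = mk⇔
  (λ (fin , sub@(X⊆T , _)) → fin , sub , λ { {w} _ (u∈X , m , refl) (v∈X , n , refl) →
    cong (w ∷ʳ_) (trans (last≡0 (X⊆T u∈X)) (sym (last≡0 (X⊆T v∈X)))) })
  (λ (fin , sub , _) → fin , sub)
  where
  last≡0 : ∀ {w n} → w ∷ʳ n ∈ Staircase 0 → n ≡ 0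
  last≡0 {w} (_ , a) with z≤n ← proj₂ (All.∷ʳ⁻ {xs = w} a) = refl

-- A sentence for the parity of the marked depth

∷ʳ⋢ : ∀ w → ¬ (w ∷ʳ n ⊑ w)
∷ʳ⋢ (_ ∷ w) (_ ∷ p) = ∷ʳ⋢ w p

⊑-∷ʳ⁻ : ∀ w → u ⊑ w ∷ʳ n → u ⊑ w ⊎ u ≡ w ∷ʳ n
⊑-∷ʳ⁻ []      []          = inj₁ []
⊑-∷ʳ⁻ []      (refl ∷ []) = inj₂ refl
⊑-∷ʳ⁻ (_ ∷ w) []          = inj₁ []
⊑-∷ʳ⁻ (_ ∷ w) (refl ∷ p) with ⊑-∷ʳ⁻ w p
... | inj₁ u⊑w = inj₁ (refl ∷ u⊑w)
... | inj₂ eq  = inj₂ (cong (_ ∷_) eq)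

_<ᶠ_ : Fin m → Fin m → Formula L AP m k
x <ᶠ y = (x ≤ᶠ y) ∧ᶠ (¬ᶠ (y ≤ᶠ x))

covers : Fin m → Fin m → Formula L AP m k
covers x y = (x <ᶠ y) ∧ᶠ (¬ᶠ ∃₁ ((suc x <ᶠ zero) ∧ᶠ (zero <ᶠ suc y)))

-- If `v` extends `u` by two or more letters, the first of them gives a word strictly in between,
-- and convexity of the tree makes that word a node.
covers-correct : ∀ (K : KripkeTree AP) (ρ : Vector (Node K) m) (σ : Vector (Pred Word 0ℓ) k)
  x y → Sat {L} K ρ σ (covers x y) ⇔ (∃ λ n → proj₁ (ρ y) ≡ proj₁ (ρ x) ∷ʳ n)
covers-correct K ρ σ x y with ρ x | ρ y
... | u , u∈K | v , v∈K = mk⇔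
  (λ ((lift u⊑v , v⋢u) , none) → case ⊑⇒++ u⊑v of λ where
    ([] , refl) → contradiction (lift (subst (_⊑ u) (sym (++-identityʳ u)) ⊑-refl)) v⋢u
    (n ∷ [] , refl) → n , refl
    (n ∷ r@(_ ∷ _) , refl) → ⊥-elim (none ((u ∷ʳ n ,
      Tree.convex (isTree K) u∈K v∈K (⊑-++ u _) (++⁺-⊑ u (refl ∷ []))) ,
      (lift (⊑-++ u _) , ∷ʳ⋢ u ∘ lower) ,
      (lift (++⁺-⊑ u (refl ∷ [])) , λ (lift p) → case ++⁻-⊑ u p of λ { (_ ∷ ()) }))))
  (λ { (n , refl) → (lift (⊑-++ u _) , ∷ʳ⋢ u ∘ lower) ,
    λ ((z , _) , (_ , z⋢u) , (lift z⊑v , v⋢z)) → case ⊑-∷ʳ⁻ u z⊑v of λ where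
      (inj₁ z⊑u)  → z⋢u (lift z⊑u)
      (inj₂ refl) → v⋢z (lift ⊑-refl) })

⊑-zeros : ∀ N → w ⊑ zeros N → ∃ λ i → w ≡ zeros i
⊑-zeros zero    []         = 0 , refl
⊑-zeros (suc N) []         = 0 , refl
⊑-zeros (suc N) (refl ∷ p) with i , refl ← ⊑-zeros N p = suc i , refl

∷ʳ-⊑-zeros : ∀ i N → zeros i ∷ʳ n ⊑ zeros N → i < N × n ≡ 0
∷ʳ-⊑-zeros zero    (suc N) (refl ∷ _) = s≤s z≤n , refl
∷ʳ-⊑-zeros (suc i) (suc N) (_ ∷ p) with i<N , n≡0 ← ∷ʳ-⊑-zeros i N p = s≤s i<N , n≡0

zeros-∷ʳ : ∀ i → zeros i ∷ʳ 0 ≡ zeros (suc i)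
zeros-∷ʳ zero    = refl
zeros-∷ʳ (suc i) = cong (0 ∷_) (zeros-∷ʳ i)

zeros-injective : ∀ {i j} → zeros i ≡ zeros j → i ≡ j
zeros-injective {i} {j} eq =
  trans (sym (length-replicate i)) (trans (cong length eq) (length-replicate j))

zeros∈ : ∀ i → zeros i ∈ Staircase b
zeros∈ zero    = [] , []
zeros∈ (suc i) = to ∷-staircase (zeros∈ i)

-- Exclusive or of `Q i` and `Q (suc i)`, with the disjunction in the negated form to which the
-- connectives of the logic lead.
Alternates : ℕ → Pred ℕ 0ℓ → Set
Alternates N Q = ∀ i → i < N → ¬ (¬ (Q i × ¬ Q (suc i)) × ¬ (Q (suc i) × ¬ Q i))

alternates-first : ∀ {Q} → ¬ ¬ Q 0 → Alternates (suc N) Q → ¬ Q 1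
alternates-first q₀ alt q₁ =
  q₀ λ q → alt 0 (s≤s z≤n) ((λ (_ , ¬q₁) → ¬q₁ q₁) , λ (_ , ¬q₀) → ¬q₀ q)

-- Induction in steps of two. Position 0 is assumed only up to double negation, since this is all
-- that the step recovers for position 2.
alternates-odd : ∀ n Q → ¬ ¬ Q 0 → Alternates (suc (n * 2)) Q → ¬ Q (suc (n * 2))
alternates-odd zero    Q q₀ alt = alternates-first {Q = Q} q₀ alt
alternates-odd (suc n) Q q₀ alt =
  alternates-odd n (λ i → Q (suc (suc i)))
    (λ ¬q₂ → alt 1 (s≤s (s≤s z≤n))
      ((λ (q₁ , _) → alternates-first {Q = Q} q₀ alt q₁) , λ (q₂ , _) → ¬q₂ q₂))
    (λ i i<n → alt (suc (suc i)) (s≤s (s≤s i<n)))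

parity : ∀ i → ∃ λ j → i ≡ j * 2 ⊎ i ≡ suc (j * 2)
parity zero          = 0 , inj₁ refl
parity (suc zero)    = 0 , inj₂ refl
parity (suc (suc i)) with parity i
... | j , inj₁ refl = suc j , inj₁ refl
... | j , inj₂ refl = suc j , inj₂ refl

odd≢even : ∀ i j → suc (i * 2) ≢ j * 2
odd≢even (suc i) (suc j) eq = odd≢even i j (suc-injective (suc-injective eq))

alternates-even : ∀ n Q → (∀ j → j ≤ n → Q (j * 2)) → (∀ j → ¬ Q (suc (j * 2))) →
                  Alternates (n * 2) Q
alternates-even n Q even odd i i<N (h , h′) with parity i
... | j , inj₁ refl = h (even j (*-cancelʳ-≤ j n 2 (<⇒≤ i<N)) , odd j)
... | j , inj₂ refl = h′ (even (suc j) (*-cancelʳ-≤ (suc j) n 2 i<N) , odd j)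

-- θ x says that x belongs to the set of nodes encoded by the quantified set.
module Parity {L} (θ : ∀ {m} → Fin m → Formula L 1 m 1) where

  isRoot : Fin m → Formula L 1 m k
  isRoot x = ¬ᶠ ∃₁ (¬ᶠ (suc x ≤ᶠ zero))

  isLast : Fin m → Formula L 1 m k
  isLast x = P zero x ∧ᶠ (¬ᶠ ∃₁ (P zero zero ∧ᶠ (¬ᶠ (zero ≤ᶠ suc x))))

  alternates : Formula L 1 0 1
  alternates = ¬ᶠ ∃₁ ∃₁ ((P zero (suc zero) ∧ᶠ P zero zero) ∧ᶠ (covers (suc zero) zero ∧ᶠ
    ((¬ᶠ (θ (suc zero) ∧ᶠ (¬ᶠ θ zero))) ∧ᶠ (¬ᶠ (θ zero ∧ᶠ (¬ᶠ θ (suc zero)))))))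

  -- A set that alternates along the marked ray and contains the root picks out the even depths
  -- there, so it contains the last marked node only if that depth is even.
  evenDepth : Sentence L 1
  evenDepth = ∃₂ ((∃₁ (isRoot zero ∧ᶠ θ zero)) ∧ᶠ ((∃₁ (isLast zero ∧ᶠ θ zero)) ∧ᶠ alternates))

  -- `Θ N X` is the set of nodes that `X` encodes. It may depend on `N` because the comb encoding
  -- recognises a tooth by its missing mark.
  module _ {b} (Θ : ℕ → Pred Word 0ℓ → Pred Word 0ℓ)
    (θ-correct : ∀ N {m} (ρ : Vector (Node (stairs b N)) m) {X} → X ∈ Range L (Staircase b) →
      ∀ x → Sat (stairs b N) ρ (X ▹ ∅) (θ x) ⇔ Θ N X (proj₁ (ρ x)))
    where

    evenDepth-sound : stairs b N ⊨ evenDepth → ∃ λ X → Θ N X [] × Θ N X (zeros N) ×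
                      Alternates N (Θ N X ∘ zeros)
    evenDepth-sound {N} (X , X∈R , (r@(u , _) , isRoot-r , θr) ,
                         (l@(v , _) , (Pl , isLast-l) , θl) , alt) =
      X , subst (Θ N X) u≡[] (to (θ-correct N (r ▹ ∅) X∈R zero) θr) ,
      subst (Θ N X) v≡N (to (θ-correct N (l ▹ ∅) X∈R zero) θl) , step
      where
      u≡[] : u ≡ []
      u≡[] = ⊑-antisym (decidable-stable (u ⊑? []) λ u⋢[] →
        isRoot-r (([] , zeros∈ 0) , u⋢[] ∘ lower)) []
      v≡N : v ≡ zeros N
      v≡N = ⊑-antisym (to (marked v) Pl) (decidable-stable (zeros N ⊑? v) λ N⋢v →
        isLast-l ((zeros N , zeros∈ N) , from (marked (zeros N)) ⊑-refl , N⋢v ∘ lower))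
      step : Alternates N (Θ N X ∘ zeros)
      step i i<N (h , h′) = alt (xᵢ , xᵢ₊₁ ,
        (from (marked (zeros i)) (zeros-mono (<⇒≤ i<N)) ,
         from (marked (zeros (suc i))) (zeros-mono i<N)) ,
        from (covers-correct {L = L} (stairs b N) ρ (X ▹ ∅) (suc zero) zero) (0 , sym (zeros-∷ʳ i)) ,
        (λ (p , ¬q) → h (to (θ⇔ (suc zero)) p , ¬q ∘ from (θ⇔ zero))) ,
        (λ (p , ¬q) → h′ (to (θ⇔ zero) p , ¬q ∘ from (θ⇔ (suc zero)))))
        where
        xᵢ xᵢ₊₁ : Node (stairs b N)
        xᵢ = zeros i , zeros∈ i
        xᵢ₊₁ = zeros (suc i) , zeros∈ (suc i)
        ρ = xᵢ₊₁ ▹ (xᵢ ▹ ∅)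
        θ⇔ = θ-correct N ρ X∈R

    evenDepth-complete : ∀ X → X ∈ Range L (Staircase b) → Θ N X [] → Θ N X (zeros N) →
                         Alternates N (Θ N X ∘ zeros) → stairs b N ⊨ evenDepth
    evenDepth-complete {N} X X∈R q₀ qN alt = X , X∈R ,
      (root , (λ (_ , h) → h (lift [])) , from (θ-correct N (root ▹ ∅) X∈R zero) q₀) ,
      (last ,
        (from (marked (zeros N)) ⊑-refl ,
         λ ((y , _) , Py , y⋢N) → y⋢N (lift (to (marked y) Py))) ,
        from (θ-correct N (last ▹ ∅) X∈R zero) qN) ,
      noStep
      where
      root last : Node (stairs b N)
      root = [] , zeros∈ 0
      last = zeros N , zeros∈ N
      step : u ⊑ zeros N → v ⊑ zeros N → (∃ λ n → v ≡ u ∷ʳ n) →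
             ¬ (Θ N X u × ¬ Θ N X v) → ¬ ¬ (Θ N X v × ¬ Θ N X u)
      -- Marked nodes are words of zeros, so a marked child of `zeros i` can only be
      -- `zeros (suc i)`.
      step u⊑N v⊑N (n , refl) h h′ with i , refl ← ⊑-zeros N u⊑N
        with i<N , refl ← ∷ʳ-⊑-zeros i N v⊑N rewrite zeros-∷ʳ i = alt i i<N (h , h′)
      noStep : Sat (stairs b N) ∅ (X ▹ ∅) alternates
      noStep (x , y , (Px , Py) , cov , h , h′) =
        step (to (marked (proj₁ x)) Px) (to (marked (proj₁ y)) Py)
          (to (covers-correct {L = L} (stairs b N) ρ (X ▹ ∅) (suc zero) zero) cov)
          (λ (p , ¬q) → h (from (θ⇔ (suc zero)) p , ¬q ∘ to (θ⇔ zero)))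
          (λ (p , ¬q) → h′ (from (θ⇔ zero) p , ¬q ∘ to (θ⇔ (suc zero))))
        where
        ρ = y ▹ (x ▹ ∅)
        θ⇔ = θ-correct N ρ X∈R

    even-⊨ : ∀ n X → X ∈ Range L (Staircase b) →
      (∀ j → j ≤ n → zeros (j * 2) ∈ Θ (n * 2) X) →
      (∀ j → ¬ (zeros (suc (j * 2)) ∈ Θ (n * 2) X)) → stairs b (n * 2) ⊨ evenDepth
    even-⊨ n X X∈R even odd =
      evenDepth-complete X X∈R (even 0 z≤n) (even n ≤-refl) (alternates-even n _ even odd)

    odd-⊭ : ∀ n → ¬ (stairs b (suc (n * 2)) ⊨ evenDepth)
    odd-⊭ n s with X , q₀ , qN , alt ← evenDepth-sound s =
      alternates-odd n _ (λ ¬q₀ → ¬q₀ q₀) alt qN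

-- The two strictness results

separation : ∀ b → (∀ X → X ∈ Range L (Staircase b) ⇔ X ∈ Range WMPL (Staircase b)) →
  (φ : Sentence L′ 1) → (∀ n → stairs b (n * 2) ⊨ φ) → (∀ n → ¬ (stairs b (suc (n * 2)) ⊨ φ)) →
  ¬ (L′ ≤[ FinitelyBranchingTrees ] L)
separation b range φ even odd L′≤L with ψ , φ⇔ψ ← L′≤L 1 φ =
  odd (gap ψ) (from (φ⇔ψ (stairs b (suc depth)) staircase-finitelyBranching)
    (to (transfer-sentence range depth ψ (m≤m*n (gap ψ) 2))
      (to (φ⇔ψ (stairs b depth) staircase-finitelyBranching) (even (gap ψ)))))
  -- An even depth, and large enough for `ψ` not to notice the step to `suc depth`, which `φ` does
  -- notice.
  where depth = gap ψ * 2

WMSO≰WMTL : ¬ (WMSO ≤[ FinitelyBranchingTrees ] WMTL)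
WMSO≰WMTL = separation 0 ray-range evenDepth even (odd-⊭ Θ θ-correct)
  where
  θ : Fin m → Formula WMSO 1 m 1
  θ x = x ∈ᶠ zero
  open Parity θ
  Θ : ℕ → Pred Word 0ℓ → Pred Word 0ℓ
  Θ _ X = X
  θ-correct : ∀ N {m} (ρ : Vector (Node (stairs 0 N)) m) {X} → X ∈ Range WMSO (Staircase 0) →
      ∀ x → Sat (stairs 0 N) ρ (X ▹ ∅) (θ x) ⇔ proj₁ (ρ x) ∈ X
  θ-correct N ρ _ x = mk⇔ lower lift
  even : ∀ n → stairs 0 (n * 2) ⊨ evenDepth
  -- The witness is the set of all `zeros (j * 2)` with `j ≤ n`, which includes both the root and
  -- the last marked node.
  even n = even-⊨ Θ θ-correct n (_∈ˡ evens) ((evens , id , id) , ⊆T)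
    (λ j j≤n → ∈-map⁺ f (∈-upTo⁺ (s≤s j≤n)))
    (λ j p → let i , _ , eq = ∈-map⁻ f {xs = upTo (suc n)} p in odd≢even j i (zeros-injective eq))
    where
    f : ℕ → Word
    f j = zeros (j * 2)
    evens = map f (upTo (suc n))
    ⊆T : (_∈ˡ evens) ⊆ Staircase 0
    ⊆T p with i , _ , refl ← ∈-map⁻ f {xs = upTo (suc n)} p = zeros∈ (i * 2)

Below : List Word → Pred Word 0ℓ
Below xs w = ∃ λ v → v ∈ˡ xs × w ⊑ v

below-finite : ∀ xs → Finite (Below xs)
below-finite xs = concatMap inits xs ,
  (λ (v , v∈xs , w⊑v) → ∈-concatMap⁺ inits (lose v∈xs (⊑⇒∈inits w⊑v))) ,
  (λ w∈ → let v , v∈xs , w∈v = find (∈-concatMap⁻ inits {xs = xs} w∈) in v , v∈xs , ∈inits⇒⊑ v w∈v)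

-- The list is nonempty so that the empty word, which serves as root, lies below some entry.
below-range : ∀ {x xs} → All (_∈ Staircase b) (x ∷ xs) → Below (x ∷ xs) ∈ Range WMTL (Staircase b)
below-range {x = x} {xs} all = below-finite (x ∷ xs) ,
  (λ (v , v∈xs , w⊑v) → Tree.downward staircase-isTree (All.lookup all v∈xs) [] w⊑v) ,
  mkTree [] (x , here refl , []) (λ _ → [])
    (λ (v , v∈xs , w⊑v) _ y⊑w → v , v∈xs , ⊑-trans y⊑w w⊑v)

WMTL≰WMPL : ¬ (WMTL ≤[ FinitelyBranchingTrees ] WMPL)
WMTL≰WMPL = separation 1 (λ X → mk⇔ id id) evenDepth even (odd-⊭ Θ θ-correct)
  where
  -- A position is encoded by an unmarked child in the subtree. The ray nodes that lead to later
  -- teeth are marked and thus encode nothing.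
  θ : Fin m → Formula WMTL 1 m 1
  θ x = ∃₁ ((zero ∈ᶠ zero) ∧ᶠ ((¬ᶠ P zero zero) ∧ᶠ covers (suc x) zero))
  open Parity θ
  Θ : ℕ → Pred Word 0ℓ → Pred Word 0ℓ
  Θ N X w = ∃ λ n → w ∷ʳ n ∈ X × ¬ (w ∷ʳ n ⊑ zeros N)
  θ-correct : ∀ N {m} (ρ : Vector (Node (stairs 1 N)) m) {X} → X ∈ Range WMTL (Staircase 1) →
      ∀ x → Sat (stairs 1 N) ρ (X ▹ ∅) (θ x) ⇔ proj₁ (ρ x) ∈ Θ N X
  θ-correct N ρ {X} (_ , X⊆T , _) x = mk⇔
    (λ ((y , y∈T) , lift y∈X , ¬Py , cov) → fwd y∈X
       (¬Py ∘ from (marked y))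
       (to (covers-correct {L = WMTL} (stairs 1 N) ((y , y∈T) ▹ ρ) (X ▹ ∅) (suc x) zero) cov))
    (λ (n , y∈X , y⋢N) → (proj₁ (ρ x) ∷ʳ n , X⊆T y∈X) , lift y∈X ,
       y⋢N ∘ to (marked _) ,
       from (covers-correct {L = WMTL} (stairs 1 N) ((_ , X⊆T y∈X) ▹ ρ) (X ▹ ∅) (suc x) zero) (n , refl))
    where
    fwd : y ∈ X → ¬ (y ⊑ zeros N) → (∃ λ n → y ≡ w ∷ʳ n) → w ∈ Θ N X
    fwd y∈X y⋢N (n , refl) = n , y∈X , y⋢N
  even : ∀ n → stairs 1 (n * 2) ⊨ evenDepth
  even n = even-⊨ Θ θ-correct n (Below teeth)
    (below-range (All.map⁺ (All.universal (λ j → tooth∈ (j * 2)) (upTo (suc n)))))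
    (λ j j≤n → 1 , (_ , ∈-map⁺ (λ j → tooth (j * 2)) (∈-upTo⁺ (s≤s j≤n)) , ⊑-refl) ,
      λ p → case ∷ʳ-⊑-zeros (j * 2) (n * 2) p of λ ())
    odd
    where
    tooth : ℕ → Word
    tooth i = zeros i ∷ʳ 1
    tooth∈ : ∀ i → tooth i ∈ Staircase 1
    tooth∈ i = proj₁ (staircase-nonBlocking (zeros∈ {1} i) .proj₂)
    teeth = map (λ j → tooth (j * 2)) (upTo (suc n))
    odd : ∀ j → ¬ (zeros (suc (j * 2)) ∈ Θ (n * 2) (Below teeth))
    odd j (m , (v , v∈ , w⊑v) , w⋢N) with i , i∈ , refl ← ∈-map⁻ (λ j → tooth (j * 2)) v∈
      with ⊑-∷ʳ⁻ (zeros (i * 2)) w⊑v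
    -- A proper prefix of a tooth is a ray node of depth at most `n * 2`, hence marked.
    ... | inj₁ w⊑i =
      w⋢N (⊑-trans w⊑i (zeros-mono (*-monoˡ-≤ 2 (s≤s⁻¹ (∈-upTo⁻ i∈)))))
    ... | inj₂ eq = odd≢even j i (zeros-injective (∷ʳ-injectiveˡ _ _ eq))

-- Equivalence over all trees is the stronger demand, so a failure of inclusion on
-- finitely-branching trees carries over to all trees.
restrict : L ≤[ AllTrees ] L′ → L ≤[ FinitelyBranchingTrees ] L′
restrict L≤L′ AP φ = let ψ , φ⇔ψ = L≤L′ AP φ in ψ , λ K _ → φ⇔ψ K _

corollary3 : (WMPL <[ AllTrees ] WMTL × WMTL <[ AllTrees ] WMSO) ×
    (WMPL <[ FinitelyBranchingTrees ] WMTL × WMTL <[ FinitelyBranchingTrees ] WMSO)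
corollary3 =
  ((WMPL≤WMTL , WMTL≰WMPL ∘ restrict) , (WMTL≤WMSO , WMSO≰WMTL ∘ restrict)) ,
  ((WMPL≤WMTL , WMTL≰WMPL) , (WMTL≤WMSO , WMSO≰WMTL))
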